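{- Let $n\ge 1$ and $0\le k\le n$ be integers. Then $$\begin{bmatrix} n\\ k\end{bmatrix}_{\mathcal{F}}=[F_{k+1}]_{q^{F_{n-k}}}\begin{bmatrix} n-1\\ k\end{bmatrix}_{\mathcal{F}}+q^{F_{n-k}F_{k+1}}\,[F_{n-1-k}]_{q^{F_{k}}}\begin{bmatrix} n-1\\ k-1\end{bmatrix}_{\mathcal{F}}.$$
   Context: Fibonacci numbers: $F_0=0$, $F_1=1$, $F_n=F_{n-1}+F_{n-2}$ (extended by the same recurrence, so that $F_{ -1}=1$). For an integer $m\ge 0$, $[m]_q=\sum_{i=0}^{m-1}q^i$, with $q$ an indeterminate, and $[m]_{q^s}=\sum_{i=0}^{m-1}q^{si}$ for an integer $s\ge 0$ (so $[m]_{q^0}=m$). Put $[F_m]_q!=\prod_{i=1}^m [F_i]_q$ (with $[F_0]_q!=1$). The $q$-Fibonomial coefficient is, for integers $0\le k\le n$, $$\begin{bmatrix} n\\ k\end{bmatrix}_{\mathcal{F}}=\frac{[F_n]_q!}{[F_k]_q!\,[F_{n-k}]_q!},$$ and it is $0$ if $k<0$ or $k>n$. -}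

module Defs where

open import Data.Integer as ℤ using (ℤ; +_; -[1+_]; 0ℤ; 1ℤ)
import Data.Integer.Properties as ℤₚ
open import Data.List using (List; []; _∷_; map)
open import Data.List.Relation.Unary.Any using (Any; here; there)
open import Data.Nat as ℕ using (ℕ; zero; suc; _∸_; _≤?_)
open import Data.Sum using ([_,_]′)
open import Relation.Binary.PropositionalEquality
open import Relation.Nullary using (yes; no)
open import Data.Empty using (⊥-elim)

infix  4 _≈_ _≃_
infixl 6 _+_ _+ʳ_
infixl 7 _*_ _*ʳ_
infixr 8 _^_

-- ℤ[q]: a polynomial is the list of its coefficients, constant term first.
-- Trailing zeros are allowed, so equality is _≈_ and not _≡_.

Poly : Set
Poly = List ℤ

coeff : Poly → ℕ → ℤ
coeff []      _       = 0ℤ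
coeff (a ∷ p) zero    = a
coeff (a ∷ p) (suc i) = coeff p i

_≈_ : Poly → Poly → Set
p ≈ r = ∀ i → coeff p i ≡ coeff r i

0ₚ 1ₚ q : Poly
0ₚ = []
1ₚ = 1ℤ ∷ []
q  = 0ℤ ∷ 1ℤ ∷ []

_+_ : Poly → Poly → Poly
[]      + r       = r
(a ∷ p) + []      = a ∷ p
(a ∷ p) + (b ∷ r) = (a ℤ.+ b) ∷ (p + r)

_*_ : Poly → Poly → Poly
[]      * r = []
(a ∷ p) * r = map (a ℤ.*_) r + (0ℤ ∷ (p * r))

_^_ : Poly → ℕ → Poly
p ^ zero  = 1ₚ
p ^ suc n = p * p ^ n

∑< : ℕ → (ℕ → Poly) → Poly
∑< zero    f = 0ₚ
∑< (suc m) f = ∑< m f + f m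

NonZero : Poly → Set
NonZero = Any (_≢ 0ℤ)

coeff-+ : ∀ p r i → coeff (p + r) i ≡ coeff p i ℤ.+ coeff r i
coeff-+ []      r       i       = sym (ℤₚ.+-identityˡ _)
coeff-+ (a ∷ p) []      i       = sym (ℤₚ.+-identityʳ _)
coeff-+ (a ∷ p) (b ∷ r) zero    = refl
coeff-+ (a ∷ p) (b ∷ r) (suc i) = coeff-+ p r i

NonZero-resp-≈ : ∀ p r → p ≈ r → NonZero p → NonZero r
NonZero-resp-≈ (a ∷ p) []      e (here a≢0) = ⊥-elim (a≢0 (e 0))
NonZero-resp-≈ (a ∷ p) (b ∷ r) e (here a≢0) = here λ b≡0 → a≢0 (trans (e 0) b≡0)
NonZero-resp-≈ (a ∷ p) []      e (there nz)
  with () ← NonZero-resp-≈ p [] (λ i → e (suc i)) nz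
NonZero-resp-≈ (a ∷ p) (b ∷ r) e (there nz) =
  there (NonZero-resp-≈ p r (λ i → e (suc i)) nz)

private
  data Lowest : Poly → Set where
    low   : ∀ {a p} → a ≢ 0ℤ → Lowest (a ∷ p)
    shift : ∀ {p} → Lowest p → Lowest (0ℤ ∷ p)

  lowest : ∀ {p} → NonZero p → Lowest p
  lowest (here a≢0) = low a≢0
  lowest (there {x = a} nz) with a ℤ.≟ 0ℤ
  ... | yes refl = shift (lowest nz)
  ... | no a≢0   = low a≢0

  *-shift : ∀ p r → p * (0ℤ ∷ r) ≈ 0ℤ ∷ (p * r)
  *-shift []      r zero    = refl
  *-shift []      r (suc i) = refl
  *-shift (a ∷ p) r zero    = trans (ℤₚ.+-identityʳ _) (ℤₚ.*-zeroʳ a)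
  *-shift (a ∷ p) r (suc i) = begin
    coeff (map (a ℤ.*_) r + p * (0ℤ ∷ r)) i
      ≡⟨ coeff-+ (map (a ℤ.*_) r) _ i ⟩
    coeff (map (a ℤ.*_) r) i ℤ.+ coeff (p * (0ℤ ∷ r)) i
      ≡⟨ cong (λ z → coeff (map (a ℤ.*_) r) i ℤ.+ z) (*-shift p r i) ⟩
    coeff (map (a ℤ.*_) r) i ℤ.+ coeff (0ℤ ∷ (p * r)) i
      ≡⟨ coeff-+ (map (a ℤ.*_) r) _ i ⟨
    coeff (map (a ℤ.*_) r + (0ℤ ∷ (p * r))) i ∎
    where open ≡-Reasoning

  coeff-0* : ∀ r i → coeff (map (0ℤ ℤ.*_) r) i ≡ 0ℤ
  coeff-0* []      i       = refl
  coeff-0* (b ∷ r) zero    = refl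
  coeff-0* (b ∷ r) (suc i) = coeff-0* r i

  *-lowest : ∀ {p r} → Lowest p → Lowest r → NonZero (p * r)
  *-lowest {r = r} (shift {p} lp) lr =
    NonZero-resp-≈ (0ℤ ∷ (p * r)) _
      (λ i → sym (trans (coeff-+ (map (0ℤ ℤ.*_) r) _ i)
                 (trans (cong (ℤ._+ coeff (0ℤ ∷ (p * r)) i) (coeff-0* r i))
                        (ℤₚ.+-identityˡ _))))
      (there (*-lowest lp lr))
  *-lowest {a ∷ p} {b ∷ r} (low a≢0) (low b≢0) = here λ e →
    [ a≢0 , b≢0 ]′ (ℤₚ.i*j≡0⇒i≡0∨j≡0 a (trans (sym (ℤₚ.+-identityʳ _)) e))
  *-lowest {a ∷ p} (low a≢0) (shift {r} lr) =
    NonZero-resp-≈ (0ℤ ∷ ((a ∷ p) * r)) ((a ∷ p) * (0ℤ ∷ r))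
      (λ i → sym (*-shift (a ∷ p) r i))
      (there (*-lowest {a ∷ p} (low a≢0) lr))

*-nonZero : ∀ {p r} → NonZero p → NonZero r → NonZero (p * r)
*-nonZero nzp nzr = *-lowest (lowest nzp) (lowest nzr)

1ₚ-nonZero : NonZero 1ₚ
1ₚ-nonZero = here λ ()

-- The fraction field of ℤ[q], that is ℚ(q).

record RatFun : Set where
  constructor mkRatFun
  field
    num         : Poly
    den         : Poly
    den-nonZero : NonZero den

open RatFun public

_≃_ : RatFun → RatFun → Set
x ≃ y = num x * den y ≈ num y * den x

fromPoly : Poly → RatFun
fromPoly p = mkRatFun p 1ₚ 1ₚ-nonZero

0ʳ : RatFun
0ʳ = fromPoly 0ₚ

_+ʳ_ : RatFun → RatFun → RatFun
x +ʳ y = mkRatFun (num x * den y + num y * den x) (den x * den y)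
                  (*-nonZero (den-nonZero x) (den-nonZero y))

_*ʳ_ : RatFun → RatFun → RatFun
x *ʳ y = mkRatFun (num x * num y) (den x * den y)
                  (*-nonZero (den-nonZero x) (den-nonZero y))

F : ℕ → ℕ
F zero          = 0
F (suc zero)    = 1
F (suc (suc n)) = F (suc n) ℕ.+ F n

-- F[ m -1] is F_{m-1}; its value at m = 0 is F_{-1} = F_1 - F_0 = 1.
F[_-1] : ℕ → ℕ
F[ zero  -1] = 1
F[ suc m -1] = F m

[_]q : ℕ → Poly
[ m ]q = ∑< m λ i → q ^ i

-- [ m ]q^ s is [m] with q replaced by q ^ s, and not a power of [ m ]q.
[_]q^_ : ℕ → ℕ → Poly
[ m ]q^ s = ∑< m λ i → q ^ (s ℕ.* i)

-- [F m ]q! is the product of [ F i ]q over 1 ≤ i ≤ m.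
[F_]q! : ℕ → Poly
[F zero  ]q! = 1ₚ
[F suc m ]q! = [F m ]q! * [ F (suc m) ]q

private
  coeff₀-q^ : ∀ n → coeff (q ^ suc n) 0 ≡ 0ℤ
  coeff₀-q^ n = trans (coeff-+ (map (0ℤ ℤ.*_) (q ^ n)) _ 0)
                (trans (ℤₚ.+-identityʳ _) (coeff-0* (q ^ n) 0))

  coeff₀-[]q : ∀ m → coeff [ suc m ]q 0 ≡ 1ℤ
  coeff₀-[]q zero    = refl
  coeff₀-[]q (suc m) =
    trans (coeff-+ [ suc m ]q _ 0) (cong₂ ℤ._+_ (coeff₀-[]q m) (coeff₀-q^ m))

  coeff₀-nonZero : ∀ p → coeff p 0 ≡ 1ℤ → NonZero p
  coeff₀-nonZero (a ∷ p) refl = here λ ()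

[]q-nonZero : ∀ m → .{{ℕ.NonZero m}} → NonZero [ m ]q
[]q-nonZero (suc m) = coeff₀-nonZero [ suc m ]q (coeff₀-[]q m)

F-nonZero : ∀ n → ℕ.NonZero (F (suc n))
F-nonZero zero = _
F-nonZero (suc n) with F (suc n) | F-nonZero n
... | suc _ | _ = _

[F]q!-nonZero : ∀ m → NonZero [F m ]q!
[F]q!-nonZero zero    = 1ₚ-nonZero
[F]q!-nonZero (suc m) =
  *-nonZero ([F]q!-nonZero m) ([]q-nonZero (F (suc m)) {{F-nonZero m}})

qFibonomial : ℕ → ℤ → RatFun
qFibonomial n -[1+ _ ] = 0ʳ
qFibonomial n (+ k) with k ≤? n
... | yes _ = mkRatFun [F n ]q! ([F k ]q! * [F n ∸ k ]q!)
                       (*-nonZero ([F]q!-nonZero k) ([F]q!-nonZero (n ∸ k)))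
... | no _  = 0ʳ

{-# OPTIONS --safe #-}

-- Writing m = n − k, the Fibonacci addition formula F n = F (k+1) F m + F k F (m−1)
-- cuts the q-integer [ F n ]q into F (k+1) blocks of length F m followed, after a
-- shift by q ^ (F m F (k+1)), by F (m−1) blocks of length F k.  Multiplying this by
-- [F n−1 ]q! and dividing by [F k ]q! [F m ]q! gives the recurrence.
module Submission where

open import Algebra.Bundles using (CommutativeSemiring)
import Algebra.Solver.Ring.NaturalCoefficients.Default as SemiringSolver
open import Algebra.Structures.Biased using (isCommutativeMonoidˡ; isCommutativeSemiringˡ)
open import Data.Nat as ℕ using (ℕ; zero; suc; _∸_; _≤_; _≥_; _<_; _≤?_)
import Data.Nat.Properties as ℕₚ
open import Data.Nat.Tactic.RingSolver using () renaming (solve-∀ to ℕ-solve-∀)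
open import Data.Integer as ℤ using (ℤ; +_; _-_; 0ℤ; 1ℤ)
import Data.Integer.Properties as ℤₚ
open import Data.Integer.Tactic.RingSolver using () renaming (solve-∀ to ℤ-solve-∀)
open import Data.List using ([]; _∷_; map)
open import Function using (_∘_)
open import Level using (0ℓ)
open import Relation.Binary.PropositionalEquality
open import Relation.Binary.Structures using (IsEquivalence)
import Relation.Binary.Reasoning.Setoid as SetoidReasoning
open import Relation.Nullary using (yes; no; contradiction)
open import Defs

-- Cauchy products of sequences

-- The recursion consumes the first sequence as `_*_` consumes the coefficient list of its left
-- factor, so `coeff-*` is a direct induction and the ring laws can be proved without list lengths.
conv : (ℕ → ℤ) → (ℕ → ℤ) → ℕ → ℤ
conv f g zero    = f 0 ℤ.* g 0
conv f g (suc n) = f 0 ℤ.* g (suc n) ℤ.+ conv (f ∘ suc) g n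

conv-cong : ∀ {f f′ g g′} → f ≗ f′ → g ≗ g′ → conv f g ≗ conv f′ g′
conv-cong ff gg zero    = cong₂ ℤ._*_ (ff 0) (gg 0)
conv-cong ff gg (suc n) =
  cong₂ ℤ._+_ (cong₂ ℤ._*_ (ff 0) (gg (suc n))) (conv-cong (ff ∘ suc) gg n)

conv-zeroˡ : ∀ g → conv (λ _ → 0ℤ) g ≗ λ _ → 0ℤ
conv-zeroˡ g zero    = refl
conv-zeroˡ g (suc n) = trans (ℤₚ.+-identityˡ _) (conv-zeroˡ g n)

-- Mirror image of the defining equation, peeling off the term with `g 0` instead of `f 0`;
-- commutativity needs both.
conv-suc : ∀ f g n → conv f g (suc n) ≡ conv f (g ∘ suc) n ℤ.+ f (suc n) ℤ.* g 0
conv-suc f g zero    = refl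
conv-suc f g (suc n) =
  trans (cong (λ z → f 0 ℤ.* g (suc (suc n)) ℤ.+ z) (conv-suc (f ∘ suc) g n))
        (sym (ℤₚ.+-assoc (f 0 ℤ.* g (suc (suc n))) _ _))

conv-comm : ∀ f g → conv f g ≗ conv g f
conv-comm f g zero    = ℤₚ.*-comm (f 0) (g 0)
conv-comm f g (suc n) = begin
  f 0 ℤ.* g (suc n) ℤ.+ conv (f ∘ suc) g n
    ≡⟨ cong₂ ℤ._+_ (ℤₚ.*-comm (f 0) _) (conv-comm (f ∘ suc) g n) ⟩
  g (suc n) ℤ.* f 0 ℤ.+ conv g (f ∘ suc) n
    ≡⟨ ℤₚ.+-comm (g (suc n) ℤ.* f 0) _ ⟩
  conv g (f ∘ suc) n ℤ.+ g (suc n) ℤ.* f 0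
    ≡⟨ conv-suc g f n ⟨
  conv g f (suc n) ∎
  where open ≡-Reasoning

conv-distribʳ : ∀ f g h → conv (λ i → f i ℤ.+ g i) h ≗ λ n → conv f h n ℤ.+ conv g h n
conv-distribʳ f g h zero    = ℤₚ.*-distribʳ-+ (h 0) (f 0) (g 0)
conv-distribʳ f g h (suc n) =
  trans (cong (λ z → (f 0 ℤ.+ g 0) ℤ.* h (suc n) ℤ.+ z) (conv-distribʳ (f ∘ suc) (g ∘ suc) h n))
        (rearrange (f 0) (g 0) (h (suc n)) _ _)
  where
  rearrange : ∀ a b c d e → (a ℤ.+ b) ℤ.* c ℤ.+ (d ℤ.+ e) ≡ (a ℤ.* c ℤ.+ d) ℤ.+ (b ℤ.* c ℤ.+ e)
  rearrange = ℤ-solve-∀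

conv-scaleˡ : ∀ a f g → conv (λ i → a ℤ.* f i) g ≗ λ n → a ℤ.* conv f g n
conv-scaleˡ a f g zero    = ℤₚ.*-assoc a (f 0) (g 0)
conv-scaleˡ a f g (suc n) =
  trans (cong (λ z → a ℤ.* f 0 ℤ.* g (suc n) ℤ.+ z) (conv-scaleˡ a (f ∘ suc) g n))
        (rearrange a (f 0) (g (suc n)) _)
  where
  rearrange : ∀ a b c d → a ℤ.* b ℤ.* c ℤ.+ a ℤ.* d ≡ a ℤ.* (b ℤ.* c ℤ.+ d)
  rearrange = ℤ-solve-∀

conv-assoc : ∀ f g h → conv (conv f g) h ≗ conv f (conv g h)
conv-assoc f g h zero    = ℤₚ.*-assoc (f 0) (g 0) (h 0)
conv-assoc f g h (suc n) = begin
  f 0 ℤ.* g 0 ℤ.* h (suc n) ℤ.+ conv (conv f g ∘ suc) h n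
    -- By definition `conv f g ∘ suc` is a multiple of `g ∘ suc` plus `conv (f ∘ suc) g`, so
    -- linearity in the first argument leads to the induction hypothesis at `f ∘ suc`.
    ≡⟨ cong (λ z → f 0 ℤ.* g 0 ℤ.* h (suc n) ℤ.+ z) (conv-distribʳ _ (conv (f ∘ suc) g) h n) ⟩
  f 0 ℤ.* g 0 ℤ.* h (suc n)
    ℤ.+ (conv (λ i → f 0 ℤ.* g (suc i)) h n ℤ.+ conv (conv (f ∘ suc) g) h n)
    ≡⟨ cong₂ (λ y z → f 0 ℤ.* g 0 ℤ.* h (suc n) ℤ.+ (y ℤ.+ z))
             (conv-scaleˡ (f 0) (g ∘ suc) h n) (conv-assoc (f ∘ suc) g h n) ⟩
  f 0 ℤ.* g 0 ℤ.* h (suc n)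
    ℤ.+ (f 0 ℤ.* conv (g ∘ suc) h n ℤ.+ conv (f ∘ suc) (conv g h) n)
    ≡⟨ rearrange (f 0) (g 0) (h (suc n)) _ _ ⟩
  conv f (conv g h) (suc n) ∎
  where
  open ≡-Reasoning
  rearrange : ∀ a b c d e → a ℤ.* b ℤ.* c ℤ.+ (a ℤ.* d ℤ.+ e) ≡ a ℤ.* (b ℤ.* c ℤ.+ d) ℤ.+ e
  rearrange = ℤ-solve-∀

-- ℤ[q] as a commutative semiring

coeff-scale : ∀ a p i → coeff (map (a ℤ.*_) p) i ≡ a ℤ.* coeff p i
coeff-scale a []      i       = sym (ℤₚ.*-zeroʳ a)
coeff-scale a (b ∷ p) zero    = refl
coeff-scale a (b ∷ p) (suc i) = coeff-scale a p i

coeff-* : ∀ p r → coeff (p * r) ≗ conv (coeff p) (coeff r)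
coeff-* []      r i       = sym (conv-zeroˡ (coeff r) i)
coeff-* (a ∷ p) r zero    =
  trans (coeff-+ (map (a ℤ.*_) r) _ 0) (trans (ℤₚ.+-identityʳ _) (coeff-scale a r 0))
coeff-* (a ∷ p) r (suc i) =
  trans (coeff-+ (map (a ℤ.*_) r) _ (suc i))
        (cong₂ ℤ._+_ (coeff-scale a r (suc i)) (coeff-* p r i))

-- Agda unfolds _≈_ to a function type, from which it cannot infer the two polynomials;
-- the record keeps them recoverable.
record _≋_ (p r : Poly) : Set where
  constructor pointwise
  field coeffs : p ≈ r

open _≋_

infix 4 _≋_

≋-isEquivalence : IsEquivalence _≋_
≋-isEquivalence = record
  { refl  = pointwise λ i → refl
  ; sym   = λ e → pointwise λ i → sym (coeffs e i)
  ; trans = λ e f → pointwise λ i → trans (coeffs e i) (coeffs f i)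
  }

+-cong : ∀ {p p′ r r′} → p ≋ p′ → r ≋ r′ → p + r ≋ p′ + r′
+-cong {p} {p′} {r} {r′} (pointwise e) (pointwise f) = pointwise λ i →
  trans (coeff-+ p r i) (trans (cong₂ ℤ._+_ (e i) (f i)) (sym (coeff-+ p′ r′ i)))

+-assoc : ∀ p r s → (p + r) + s ≈ p + (r + s)
+-assoc p r s i = begin
  coeff ((p + r) + s) i                   ≡⟨ coeff-+ (p + r) s i ⟩
  coeff (p + r) i ℤ.+ coeff s i           ≡⟨ cong (ℤ._+ coeff s i) (coeff-+ p r i) ⟩
  coeff p i ℤ.+ coeff r i ℤ.+ coeff s i   ≡⟨ ℤₚ.+-assoc (coeff p i) _ _ ⟩
  coeff p i ℤ.+ (coeff r i ℤ.+ coeff s i) ≡⟨ cong (λ z → coeff p i ℤ.+ z) (coeff-+ r s i) ⟨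
  coeff p i ℤ.+ coeff (r + s) i           ≡⟨ coeff-+ p (r + s) i ⟨
  coeff (p + (r + s)) i                   ∎
  where open ≡-Reasoning

+-comm : ∀ p r → p + r ≈ r + p
+-comm p r i =
  trans (coeff-+ p r i) (trans (ℤₚ.+-comm (coeff p i) _) (sym (coeff-+ r p i)))

*-cong : ∀ {p p′ r r′} → p ≋ p′ → r ≋ r′ → p * r ≋ p′ * r′
*-cong {p} {p′} {r} {r′} (pointwise e) (pointwise f) = pointwise λ i →
  trans (coeff-* p r i) (trans (conv-cong e f i) (sym (coeff-* p′ r′ i)))

*-comm : ∀ p r → p * r ≈ r * p
*-comm p r i =
  trans (coeff-* p r i) (trans (conv-comm (coeff p) (coeff r) i) (sym (coeff-* r p i)))

*-assoc : ∀ p r s → (p * r) * s ≈ p * (r * s)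
*-assoc p r s i = begin
  coeff ((p * r) * s) i                           ≡⟨ coeff-* (p * r) s i ⟩
  conv (coeff (p * r)) (coeff s) i                ≡⟨ conv-cong (coeff-* p r) (λ _ → refl) i ⟩
  conv (conv (coeff p) (coeff r)) (coeff s) i     ≡⟨ conv-assoc (coeff p) _ _ i ⟩
  conv (coeff p) (conv (coeff r) (coeff s)) i     ≡⟨ conv-cong (λ _ → refl) (coeff-* r s) i ⟨
  conv (coeff p) (coeff (r * s)) i                ≡⟨ coeff-* p (r * s) i ⟨
  coeff (p * (r * s)) i                           ∎
  where open ≡-Reasoning

*-identityˡ : ∀ p → 1ₚ * p ≈ p
*-identityˡ p zero    = trans (coeff-* 1ₚ p 0) (ℤₚ.*-identityˡ (coeff p 0))
*-identityˡ p (suc i) =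
  trans (coeff-* 1ₚ p (suc i))
        (trans (cong₂ ℤ._+_ (ℤₚ.*-identityˡ (coeff p (suc i))) (conv-zeroˡ (coeff p) i))
               (ℤₚ.+-identityʳ _))

*-distribʳ-+ : ∀ s p r → (p + r) * s ≈ p * s + r * s
*-distribʳ-+ s p r i = begin
  coeff ((p + r) * s) i
    ≡⟨ coeff-* (p + r) s i ⟩
  conv (coeff (p + r)) (coeff s) i
    ≡⟨ conv-cong (coeff-+ p r) (λ _ → refl) i ⟩
  conv (λ j → coeff p j ℤ.+ coeff r j) (coeff s) i
    ≡⟨ conv-distribʳ (coeff p) (coeff r) (coeff s) i ⟩
  conv (coeff p) (coeff s) i ℤ.+ conv (coeff r) (coeff s) i
    ≡⟨ cong₂ ℤ._+_ (coeff-* p s i) (coeff-* r s i) ⟨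
  coeff (p * s) i ℤ.+ coeff (r * s) i
    ≡⟨ coeff-+ (p * s) (r * s) i ⟨
  coeff (p * s + r * s) i ∎
  where open ≡-Reasoning

polySemiring : CommutativeSemiring 0ℓ 0ℓ
polySemiring = record
  { Carrier = Poly
  ; _≈_     = _≋_
  ; _+_     = _+_
  ; _*_     = _*_
  ; 0#      = 0ₚ
  ; 1#      = 1ₚ
  ; isCommutativeSemiring = isCommutativeSemiringˡ record
    { +-isCommutativeMonoid = isCommutativeMonoidˡ record
      { isSemigroup = record
        { isMagma = record
          { isEquivalence = ≋-isEquivalence
          ; ∙-cong = +-cong
          }
        ; assoc = λ p r s → pointwise (+-assoc p r s)
        }
      ; identityˡ = λ p → pointwise λ i → refl
      ; comm      = λ p r → pointwise (+-comm p r)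
      }
    ; *-isCommutativeMonoid = isCommutativeMonoidˡ record
      { isSemigroup = record
        { isMagma = record
          { isEquivalence = ≋-isEquivalence
          ; ∙-cong = *-cong
          }
        ; assoc = λ p r s → pointwise (*-assoc p r s)
        }
      ; identityˡ = λ p → pointwise (*-identityˡ p)
      ; comm      = λ p r → pointwise (*-comm p r)
      }
    ; distribʳ = λ s p r → pointwise (*-distribʳ-+ s p r)
    ; zeroˡ    = λ p → pointwise λ i → refl
    }
  }

private module R = CommutativeSemiring polySemiring
open SemiringSolver polySemiring using (solve; _:=_; _:+_; _:*_; con)

-- q-integers

q^-+ : ∀ m n → q ^ (m ℕ.+ n) ≋ q ^ m * q ^ n
q^-+ zero    n = R.sym (R.*-identityˡ (q ^ n))
q^-+ (suc m) n = begin
  q * q ^ (m ℕ.+ n)   ≈⟨ R.*-congˡ {q} (q^-+ m n) ⟩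
  q * (q ^ m * q ^ n) ≈⟨ R.*-assoc q (q ^ m) (q ^ n) ⟨
  (q * q ^ m) * q ^ n ∎
  where open SetoidReasoning R.setoid

-- The exponents below m + n are the first m, then n more that share the factor `q ^ m`.
[]q-+ : ∀ m n → [ m ℕ.+ n ]q ≋ [ m ]q + q ^ m * [ n ]q
[]q-+ m zero rewrite ℕₚ.+-identityʳ m =
  solve 2 (λ x y → x := x :+ y :* con 0) R.refl [ m ]q (q ^ m)
[]q-+ m (suc n) rewrite ℕₚ.+-suc m n = begin
  [ m ℕ.+ n ]q + q ^ (m ℕ.+ n)
    ≈⟨ R.+-cong ([]q-+ m n) (q^-+ m n) ⟩
  ([ m ]q + q ^ m * [ n ]q) + q ^ m * q ^ n
    ≈⟨ solve 4 (λ x y z w → (x :+ y :* z) :+ y :* w := x :+ y :* (z :+ w)) R.refl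
             [ m ]q (q ^ m) [ n ]q (q ^ n) ⟩
  [ m ]q + q ^ m * ([ n ]q + q ^ n) ∎
  where open SetoidReasoning R.setoid

-- The exponents below s m fall into m blocks of length s; the block starting at s i contributes
-- `q ^ (s ℕ.* i) * [ s ]q`.
[]q-* : ∀ s m → [ s ℕ.* m ]q ≋ [ m ]q^ s * [ s ]q
[]q-* s zero    = R.reflexive (cong [_]q (ℕₚ.*-zeroʳ s))
[]q-* s (suc m) = begin
  [ s ℕ.* suc m ]q
    ≈⟨ R.reflexive (cong [_]q (trans (ℕₚ.*-suc s m) (ℕₚ.+-comm s _))) ⟩
  [ s ℕ.* m ℕ.+ s ]q
    ≈⟨ []q-+ (s ℕ.* m) s ⟩
  [ s ℕ.* m ]q + q ^ (s ℕ.* m) * [ s ]q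
    ≈⟨ R.+-congʳ ([]q-* s m) ⟩
  [ m ]q^ s * [ s ]q + q ^ (s ℕ.* m) * [ s ]q
    ≈⟨ R.distribʳ [ s ]q ([ m ]q^ s) (q ^ (s ℕ.* m)) ⟨
  ([ m ]q^ s + q ^ (s ℕ.* m)) * [ s ]q ∎
  where open SetoidReasoning R.setoid

[1]q^ : ∀ s → [ 1 ]q^ s ≡ 1ₚ
[1]q^ s = cong (q ^_) (ℕₚ.*-zeroʳ s)

-- The Fibonacci addition formula and its q-analogue

F-suc : ∀ m → F (suc m) ≡ F m ℕ.+ F[ m -1]
F-suc zero    = refl
F-suc (suc m) = refl

-- Induction on k for all m at once: one unit moves from k to m, and `F[ suc m -1]` is `F m`.
F-+ : ∀ k m → F (k ℕ.+ m) ≡ F m ℕ.* F (suc k) ℕ.+ F k ℕ.* F[ m -1]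
F-+ zero    m = base (F m)
  where
  base : ∀ x → x ≡ x ℕ.* 1 ℕ.+ 0
  base = ℕ-solve-∀
F-+ (suc k) m = begin
  F (suc k ℕ.+ m)
    ≡⟨ cong F (ℕₚ.+-suc k m) ⟨
  F (k ℕ.+ suc m)
    ≡⟨ F-+ k (suc m) ⟩
  F (suc m) ℕ.* F (suc k) ℕ.+ F k ℕ.* F m
    ≡⟨ cong (λ z → z ℕ.* F (suc k) ℕ.+ F k ℕ.* F m) (F-suc m) ⟩
  (F m ℕ.+ F[ m -1]) ℕ.* F (suc k) ℕ.+ F k ℕ.* F m
    ≡⟨ rearrange (F m) (F[ m -1]) (F (suc k)) (F k) ⟩
  F m ℕ.* (F (suc k) ℕ.+ F k) ℕ.+ F (suc k) ℕ.* F[ m -1] ∎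
  where
  open ≡-Reasoning
  rearrange : ∀ a b c d → (a ℕ.+ b) ℕ.* c ℕ.+ d ℕ.* a ≡ a ℕ.* (c ℕ.+ d) ℕ.+ c ℕ.* b
  rearrange = ℕ-solve-∀

upperCoeff lowerCoeff : ℕ → ℕ → Poly
upperCoeff k m = [ F (suc k) ]q^ (F m)
lowerCoeff k m = q ^ (F m ℕ.* F (suc k)) * [ F[ m -1] ]q^ (F k)

-- For positive k and m, `[ F m ]q` and `[ F k ]q` are the last factors of `[F m ]q!` and
-- `[F k ]q!`; cancelling one or the other leaves the denominators of the two coefficients at n - 1.
[F+]q : ∀ k m → [ F (k ℕ.+ m) ]q ≋ upperCoeff k m * [ F m ]q + lowerCoeff k m * [ F k ]q
[F+]q k m = begin
  [ F (k ℕ.+ m) ]q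
    ≈⟨ R.reflexive (cong [_]q (F-+ k m)) ⟩
  [ F m ℕ.* F (suc k) ℕ.+ F k ℕ.* F[ m -1] ]q
    ≈⟨ []q-+ (F m ℕ.* F (suc k)) _ ⟩
  [ F m ℕ.* F (suc k) ]q + shift * [ F k ℕ.* F[ m -1] ]q
    ≈⟨ R.+-cong ([]q-* (F m) (F (suc k)))
             (R.*-congˡ {shift} ([]q-* (F k) (F[ m -1]))) ⟩
  upperCoeff k m * [ F m ]q + shift * ([ F[ m -1] ]q^ (F k) * [ F k ]q)
    ≈⟨ R.+-congˡ (R.*-assoc shift ([ F[ m -1] ]q^ (F k)) [ F k ]q) ⟨
  upperCoeff k m * [ F m ]q + lowerCoeff k m * [ F k ]q ∎
  where
  open SetoidReasoning R.setoid
  shift = q ^ (F m ℕ.* F (suc k))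

-- q-Fibonomial coefficients

-- `qFibonomial` is stuck on `k ≤? n`. The hypothesis `k ℕ.+ m ≡ n` settles that test and lets m
-- replace `n ∸ k`.
num-qFibonomial : ∀ {n} k {m} → k ℕ.+ m ≡ n → num (qFibonomial n (+ k)) ≡ [F n ]q!
num-qFibonomial k {m} refl with k ≤? k ℕ.+ m
... | yes _ = refl
... | no k≰ = contradiction (ℕₚ.m≤m+n k m) k≰

den-qFibonomial : ∀ {n} k {m} → k ℕ.+ m ≡ n → den (qFibonomial n (+ k)) ≡ [F k ]q! * [F m ]q!
den-qFibonomial k {m} refl with k ≤? k ℕ.+ m
... | yes _ = cong (λ j → [F k ]q! * [F j ]q!) (ℕₚ.m+n∸m≡n k m)
... | no k≰ = contradiction (ℕₚ.m≤m+n k m) k≰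

qFibonomial-> : ∀ {n k} → n < k → qFibonomial n (+ k) ≡ 0ʳ
qFibonomial-> {n} {k} n<k with k ≤? n
... | yes k≤n = contradiction n<k (ℕₚ.≤⇒≯ k≤n)
... | no _    = refl

-- Cross-multiplication turns the equality of fractions into a polynomial identity, once the
-- denominators `1ₚ` of `fromPoly` are dropped. Numerators and denominators enter through equations
-- because those of `qFibonomial` do not compute.
≃-combination : ∀ x y z a b {X Y Z dx dy dz} →
  num x ≡ X → den x ≡ dx → num y ≡ Y → den y ≡ dy → num z ≡ Z → den z ≡ dz →
  X * (dy * dz) ≋ (a * Y * dz + b * Z * dy) * dx →
  x ≃ fromPoly a *ʳ y +ʳ fromPoly b *ʳ z
≃-combination x y z a b refl refl refl refl refl refl eq = coeffs (begin
  num x * ((1ₚ * den y) * (1ₚ * den z))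
    ≈⟨ solve 3 (λ X dy dz → X :* ((con 1 :* dy) :* (con 1 :* dz)) := X :* (dy :* dz))
             R.refl (num x) (den y) (den z) ⟩
  num x * (den y * den z)
    ≈⟨ eq ⟩
  (a * num y * den z + b * num z * den y) * den x
    ≈⟨ solve 5 (λ aY bZ dx dy dz →
                 (aY :* dz :+ bZ :* dy) :* dx
                   := (aY :* (con 1 :* dz) :+ bZ :* (con 1 :* dy)) :* dx)
             R.refl (a * num y) (b * num z) (den x) (den y) (den z) ⟩
  (a * num y * (1ₚ * den z) + b * num z * (1ₚ * den y)) * den x ∎)
  where open SetoidReasoning R.setoid

-- The recurrence at both boundaries and in the interior

Recurrence : ℕ → ℕ → ℕ → Set
Recurrence n k m =
  qFibonomial n (+ k)
    ≃ fromPoly (upperCoeff k m) *ʳ qFibonomial (n ∸ 1) (+ k)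
      +ʳ fromPoly (lowerCoeff k m) *ʳ qFibonomial (n ∸ 1) (+ k - 1ℤ)

-- Here `+ 0 - 1ℤ` is negative, so the second term is `0ʳ`; the first has coefficient 1, and both
-- q-Fibonomials are 1.
recurrence-left : ∀ n → Recurrence (suc n) 0 (suc n)
recurrence-left n =
  ≃-combination (qFibonomial (suc n) (+ 0)) (qFibonomial n (+ 0)) 0ʳ
    (upperCoeff 0 (suc n)) (lowerCoeff 0 (suc n))
    (num-qFibonomial 0 {suc n} refl) (den-qFibonomial 0 {suc n} refl)
    (num-qFibonomial 0 {n} refl) (den-qFibonomial 0 {n} refl) refl refl
    (subst (λ a → N * ((1ₚ * N′) * 1ₚ) ≋ (a * N′ * 1ₚ + b * 0ₚ * (1ₚ * N′)) * (1ₚ * N))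
           (sym ([1]q^ (F (suc n))))
           (solve 3 (λ N N′ b → N :* ((con 1 :* N′) :* con 1)
                       := (con 1 :* N′ :* con 1 :+ b :* con 0 :* (con 1 :* N′)) :* (con 1 :* N))
                  R.refl N N′ b))
  where
  N  = [F suc n ]q!
  N′ = [F n ]q!
  b  = lowerCoeff 0 (suc n)

recurrence-right : ∀ n → Recurrence (suc n) (suc n) 0
recurrence-right n =
  ≃-combination (qFibonomial (suc n) (+ suc n)) (qFibonomial n (+ suc n)) (qFibonomial n (+ n))
    a (lowerCoeff (suc n) 0)
    (num-qFibonomial (suc n) sn+0) (den-qFibonomial (suc n) sn+0)
    (cong num (qFibonomial-> (ℕₚ.n<1+n n))) (cong den (qFibonomial-> (ℕₚ.n<1+n n)))
    (num-qFibonomial n (ℕₚ.+-identityʳ n)) (den-qFibonomial n (ℕₚ.+-identityʳ n))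
    (subst (λ c → N * (1ₚ * (N′ * 1ₚ)) ≋ (a * 0ₚ * (N′ * 1ₚ) + (1ₚ * c) * N′ * 1ₚ) * (N * 1ₚ))
           (sym ([1]q^ (F (suc n))))
           (solve 3 (λ N N′ a → N :* (con 1 :* (N′ :* con 1))
                       := (a :* con 0 :* (N′ :* con 1) :+ (con 1 :* con 1) :* N′ :* con 1)
                            :* (N :* con 1))
                  R.refl N N′ a))
  where
  N  = [F suc n ]q!
  N′ = [F n ]q!
  a  = upperCoeff (suc n) 0
  sn+0 : suc n ℕ.+ 0 ≡ suc n
  sn+0 = ℕₚ.+-identityʳ (suc n)

recurrence-middle : ∀ k m → Recurrence (suc k ℕ.+ suc m) (suc k) (suc m)
recurrence-middle k m =
  ≃-combination (qFibonomial (suc n) (+ suc k)) (qFibonomial n (+ suc k)) (qFibonomial n (+ k)) a b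
    (num-qFibonomial (suc k) refl) (den-qFibonomial (suc k) refl)
    (num-qFibonomial (suc k) (sym (ℕₚ.+-suc k m))) (den-qFibonomial (suc k) (sym (ℕₚ.+-suc k m)))
    (num-qFibonomial k refl) (den-qFibonomial k refl)
    cleared
  where
  open SetoidReasoning R.setoid
  n = k ℕ.+ suc m
  N = [F n ]q!
  A = [F k ]q!
  B = [F m ]q!
  f = [ F (suc k) ]q
  g = [ F (suc m) ]q
  a = upperCoeff (suc k) (suc m)
  b = lowerCoeff (suc k) (suc m)
  -- Compared with the denominator `A * f * (B * g)` on the left, `dy` lacks `g` and `dz` lacks `f`.
  dy = A * f * B
  dz = A * (B * g)
  cleared : N * [ F (suc n) ]q * (dy * dz) ≋ (a * N * dz + b * N * dy) * (A * f * (B * g))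
  cleared = begin
    N * [ F (suc n) ]q * (dy * dz)
      -- The only step that uses Fibonacci numbers. Afterwards both sides are `a * g + b * f` times
      -- N A² B² f g.
      ≈⟨ R.*-congʳ {dy * dz} (R.*-congˡ {N} ([F+]q (suc k) (suc m))) ⟩
    N * (a * g + b * f) * (dy * dz)
      ≈⟨ solve 7 (λ N A B a b f g →
                   N :* (a :* g :+ b :* f) :* ((A :* f :* B) :* (A :* (B :* g)))
                     := (a :* N :* (A :* (B :* g)) :+ b :* N :* (A :* f :* B))
                          :* (A :* f :* (B :* g)))
               R.refl N A B a b f g ⟩
    (a * N * dz + b * N * dy) * (A * f * (B * g)) ∎

-- The bound k + m ≥ 1 rules out k = m = 0, the one case not covered by the three lemmas.
recurrence : ∀ k m → k ℕ.+ m ≥ 1 → Recurrence (k ℕ.+ m) k m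
recurrence zero    (suc m) _ = recurrence-left m
recurrence (suc k) zero    _ =
  subst (λ j → Recurrence (suc j) (suc k) 0) (sym (ℕₚ.+-identityʳ k)) (recurrence-right k)
recurrence (suc k) (suc m) _ = recurrence-middle k m

proposition3p3 : (n k : ℕ) → n ≥ 1 → k ≤ n →
    qFibonomial n (+ k)
    ≃ fromPoly ([ F (suc k) ]q^ (F (n ∸ k))) *ʳ qFibonomial (n ∸ 1) (+ k)
    +ʳ fromPoly (q ^ (F (n ∸ k) ℕ.* F (suc k)) * [ F[ n ∸ k -1] ]q^ (F k)) *ʳ qFibonomial (n ∸ 1) (+ k - 1ℤ)
proposition3p3 n k n≥1 k≤n =
  subst (λ j → Recurrence j k (n ∸ k)) k+[n∸k]≡n
        (recurrence k (n ∸ k) (subst (_≥ 1) (sym k+[n∸k]≡n) n≥1))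
  where
  k+[n∸k]≡n : k ℕ.+ (n ∸ k) ≡ n
  k+[n∸k]≡n = ℕₚ.m+[n∸m]≡n k≤n
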